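{- Let $\alpha$ be a positive integer and let $n\ge 0$ be an integer. Then the Dowling numbers $D_n(\alpha)=\sum_{k=0}^n W_\alpha(n,k)$ satisfy $$D_{n}(\alpha)=\sum_{j=0}^{n}(-1)^{n-j}\left[ \sum_{k=0}^{j}(-1)^jL^W_{j,k}(\alpha)\right] W_{\alpha}(n,j),$$ where $W_\alpha(n,j)$ are the Whitney numbers of the second kind and $L^W_{j,k}(\alpha)$ are the Whitney-Lah numbers.
   Context: The generalized factorial is $(x|\alpha)_k=\prod_{i=0}^{k-1}(x-i\alpha)$, with $(x|\alpha)_0=1$; thus $(x-1|\alpha)_k=\prod_{i=0}^{k-1}(x-1-i\alpha)$ and $(-x-1|\alpha)_k=\prod_{i=0}^{k-1}(-x-1-i\alpha)$. The Whitney numbers of the second kind $W_\alpha(n,k)$, $0\le k\le n$, are defined by the polynomial identity in $x$ $$x^n=\sum_{k=0}^{n}W_\alpha(n,k)(x-1|\alpha)_k .$$ The Dowling numbers are $D_n(\alpha)=\sum_{k=0}^n W_\alpha(n,k)$. The Whitney-Lah numbers $L^W_{n,k}(\alpha)$, $0\le k\le n$, are defined by the polynomial identity in $x$ $$(-x-1|\alpha)_n=\sum_{k=0}^{n}L^W_{n,k}(\alpha)(x-1|\alpha)_k$$ (equivalently, replacing $x$ by $-x$, $(x-1|\alpha)_n=\sum_{k=0}^{n}L^W_{n,k}(\alpha)(-x-1|\alpha)_k$). -}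

module Defs where

open import Algebra.Bundles.Raw using (RawRing)
import Algebra.Definitions.RawSemiring as RawSemiringDefs
import Algebra.Properties.CommutativeMonoid.Sum as CommutativeMonoidSum
open import Data.Fin.Base as Fin using (Fin; toℕ)
open import Data.Integer.Base as ℤ using (ℤ; 0ℤ; 1ℤ; +_)
import Data.Integer.Properties as ℤ
open import Data.Integer.Tactic.RingSolver using (solve-∀)
open import Data.List.Base using (List; []; _∷_; map)
open import Data.Nat.Base as ℕ using (ℕ; zero; suc; z≤n; s≤s)
import Data.Nat.Properties as ℕ
open import Data.Product.Base using (∃; _,_; proj₁; proj₂)
open import Data.Sum.Base using (inj₁; inj₂)
open import Data.Vec.Functional using (Vector)
open import Function.Base using (_∘_)
open import Level using (0ℓ)
open import Relation.Binary.PropositionalEquality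
  using (_≡_; refl; sym; trans; cong; cong₂; subst; module ≡-Reasoning)

------------------------------------------------------------------------
-- The polynomial ring ℤ[X]

-- Coefficients in order of increasing degree.  Trailing zeros are
-- allowed, so polynomials are compared with _≈_ and never with _≡_.
Poly : Set
Poly = List ℤ

coeff : Poly → ℕ → ℤ
coeff []      _       = 0ℤ
coeff (a ∷ p) zero    = a
coeff (a ∷ p) (suc i) = coeff p i

infix  4 _≈_
infixl 6 _+_ _-_
infixl 7 _*_
infix  8 -_

_≈_ : Poly → Poly → Set
p ≈ q = ∀ i → coeff p i ≡ coeff q i

_+_ : Poly → Poly → Poly
[]      + q       = q
(a ∷ p) + []      = a ∷ p
(a ∷ p) + (b ∷ q) = (a ℤ.+ b) ∷ (p + q)

-_ : Poly → Poly
- p = map (λ a → ℤ.- a) p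

_-_ : Poly → Poly → Poly
p - q = p + - q

_*_ : Poly → Poly → Poly
[]      * q = []
(a ∷ p) * q = map (a ℤ.*_) q + (0ℤ ∷ p * q)

const : ℤ → Poly
const a = a ∷ []

X : Poly
X = 0ℤ ∷ 1ℤ ∷ []

polyRawRing : RawRing 0ℓ 0ℓ
polyRawRing = record
  { Carrier = Poly
  ; _≈_     = _≈_
  ; _+_     = _+_
  ; _*_     = _*_
  ; -_      = -_
  ; 0#      = []
  ; 1#      = const 1ℤ
  }

open RawSemiringDefs (RawRing.rawSemiring polyRawRing) public
  using (_^_) renaming (sum to sumₚ; product to productₚ)

open CommutativeMonoidSum ℤ.+-0-commutativeMonoid public
  using (sum; sum⁺-syntax)

------------------------------------------------------------------------
-- Whitney, Dowling and Whitney–Lah numbers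

-- (y | α)ₖ = ∏_{0 ≤ i < k} (y − iα), for a polynomial y.
infix 9 ⟨_∣_⟩_
⟨_∣_⟩_ : Poly → ℤ → (k : ℕ) → Poly
⟨ y ∣ α ⟩ k = productₚ {k} λ i → y - const (+ toℕ i ℤ.* α)

Triangle : Set
Triangle = (n : ℕ) → Fin (suc n) → ℤ

-- ∑_{k=0}^{n} cₖ (X − 1 | α)ₖ
expansion : ℤ → (n : ℕ) → (Fin (suc n) → ℤ) → Poly
expansion α n c =
  sumₚ {suc n} λ k → const (c k) * ⟨ X - const 1ℤ ∣ α ⟩ toℕ k

IsWhitneySecondKind : ℤ → Triangle → Set
IsWhitneySecondKind α W = ∀ n → X ^ n ≈ expansion α n (W n)

IsWhitneyLah : ℤ → Triangle → Set
IsWhitneyLah α L =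
  ∀ n → ⟨ - X - const 1ℤ ∣ α ⟩ n ≈ expansion α n (L n)

-- Dₙ(α), where W is the triangle of the W_α(n,k).
dowling : Triangle → ℕ → ℤ
dowling W n = sum (W n)

------------------------------------------------------------------------
-- Integer triangles with these defining properties exist, because
-- (X − 1 | α)ₖ is monic of degree k.

private

  coeff-+ : ∀ p q i → coeff (p + q) i ≡ coeff p i ℤ.+ coeff q i
  coeff-+ []      q       i       = sym (ℤ.+-identityˡ _)
  coeff-+ (a ∷ p) []      i       = sym (ℤ.+-identityʳ _)
  coeff-+ (a ∷ p) (b ∷ q) zero    = refl
  coeff-+ (a ∷ p) (b ∷ q) (suc i) = coeff-+ p q i

  coeff-scale : ∀ a p i → coeff (map (a ℤ.*_) p) i ≡ a ℤ.* coeff p i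
  coeff-scale a []      i       = sym (ℤ.*-zeroʳ a)
  coeff-scale a (b ∷ p) zero    = refl
  coeff-scale a (b ∷ p) (suc i) = coeff-scale a p i

  coeff-0∷[] : ∀ i → coeff (0ℤ ∷ []) i ≡ 0ℤ
  coeff-0∷[] zero    = refl
  coeff-0∷[] (suc i) = refl

  coeff-const* : ∀ a p i → coeff (const a * p) i ≡ a ℤ.* coeff p i
  coeff-const* a p i = begin
    coeff (map (a ℤ.*_) p + (0ℤ ∷ [])) i
      ≡⟨ coeff-+ (map (a ℤ.*_) p) _ i ⟩
    coeff (map (a ℤ.*_) p) i ℤ.+ coeff (0ℤ ∷ []) i
      ≡⟨ cong₂ ℤ._+_ (coeff-scale a p i) (coeff-0∷[] i) ⟩
    a ℤ.* coeff p i ℤ.+ 0ℤ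
      ≡⟨ ℤ.+-identityʳ _ ⟩
    a ℤ.* coeff p i ∎
    where open ≡-Reasoning

  linear : ℤ → ℤ → Poly
  linear a b = a ∷ b ∷ []

  coeff-linear* : ∀ a b p i →
    coeff (linear a b * p) (suc i) ≡
    a ℤ.* coeff p (suc i) ℤ.+ b ℤ.* coeff p i
  coeff-linear* a b p i =
    trans (coeff-+ (map (a ℤ.*_) p) _ (suc i))
          (cong₂ ℤ._+_ (coeff-scale a p (suc i)) (coeff-const* b p i))

  coeff-sumₚ : ∀ {n} (v : Vector Poly n) i →
    coeff (sumₚ v) i ≡ sum (λ k → coeff (v k) i)
  coeff-sumₚ {zero}  v i = refl
  coeff-sumₚ {suc n} v i =
    trans (coeff-+ (v Fin.zero) _ i)
          (cong (λ z → coeff (v Fin.zero) i ℤ.+ z)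
                (coeff-sumₚ (v ∘ Fin.suc) i))

  a0+b0≡0 : ∀ a b → a ℤ.* 0ℤ ℤ.+ b ℤ.* 0ℤ ≡ 0ℤ
  a0+b0≡0 = solve-∀

  degree≤ : ∀ {n} (a b : Vector ℤ n) i → n ℕ.< i →
    coeff (productₚ λ k → linear (a k) (b k)) i ≡ 0ℤ
  degree≤ {zero}  a b (suc i) _         = refl
  degree≤ {suc n} a b (suc i) (s≤s n<i)
    rewrite coeff-linear* (a Fin.zero) (b Fin.zero)
              (productₚ λ k → linear (a (Fin.suc k)) (b (Fin.suc k))) i
          | degree≤ (a ∘ Fin.suc) (b ∘ Fin.suc) i n<i
          | degree≤ (a ∘ Fin.suc) (b ∘ Fin.suc) (suc i) (ℕ.m<n⇒m<1+n n<i)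
    = a0+b0≡0 (a Fin.zero) (b Fin.zero)

  a0+1≡1 : ∀ a → a ℤ.* 0ℤ ℤ.+ 1ℤ ℤ.* 1ℤ ≡ 1ℤ
  a0+1≡1 = solve-∀

  monic : ∀ {n} (a : Vector ℤ n) →
    coeff (productₚ λ k → linear (a k) 1ℤ) n ≡ 1ℤ
  monic {zero}  a = refl
  monic {suc n} a
    rewrite coeff-linear* (a Fin.zero) 1ℤ
              (productₚ λ k → linear (a (Fin.suc k)) 1ℤ) n
          | degree≤ (a ∘ Fin.suc) (λ _ → 1ℤ) (suc n) (ℕ.n<1+n n)
          | monic (a ∘ Fin.suc)
    = a0+1≡1 (a Fin.zero)

  snoc : ∀ {n} → Vector ℤ n → ℤ → Vector ℤ (suc n)
  snoc {zero}  c a _           = a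
  snoc {suc n} c a Fin.zero    = c Fin.zero
  snoc {suc n} c a (Fin.suc k) = snoc (c ∘ Fin.suc) a k

  sum-snoc : ∀ {n} (c : Vector ℤ n) a (g : ℕ → ℤ) →
    sum (λ k → snoc c a k ℤ.* g (toℕ k)) ≡
    sum (λ k → c k ℤ.* g (toℕ k)) ℤ.+ a ℤ.* g n
  sum-snoc {zero}  c a g = ℤ.+-comm (a ℤ.* g 0) 0ℤ
  sum-snoc {suc n} c a g =
    trans (cong (λ z → c Fin.zero ℤ.* g 0 ℤ.+ z)
                (sum-snoc (c ∘ Fin.suc) a (g ∘ suc)))
          (sym (ℤ.+-assoc (c Fin.zero ℤ.* g 0) _ _))

  module _ (α : ℤ) where

    basis : ℕ → ℕ → ℤ
    basis k = coeff (⟨ X - const 1ℤ ∣ α ⟩ k)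

    split : ∀ u v → u ≡ (u ℤ.- v) ℤ.+ v
    split = solve-∀

    cancel₁ : ∀ u → u ℤ.- u ℤ.* 1ℤ ≡ 0ℤ
    cancel₁ = solve-∀

    cancel₀ : ∀ u → 0ℤ ℤ.- u ℤ.* 0ℤ ≡ 0ℤ
    cancel₀ = solve-∀

    expand : ∀ n (f : ℕ → ℤ) → (∀ i → n ℕ.≤ i → f i ≡ 0ℤ) →
      ∃ λ (c : Vector ℤ n) → ∀ i → f i ≡ sum (λ k → c k ℤ.* basis (toℕ k) i)
    expand zero    f f≡0 = (λ ()) , λ i → f≡0 i z≤n
    expand (suc n) f f≡0 = snoc c (f n) , λ i →
      trans (split (f i) (f n ℤ.* basis n i))
        (trans (cong (λ z → z ℤ.+ f n ℤ.* basis n i) (g≡ i))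
               (sym (sum-snoc c (f n) (λ k → basis k i))))
      where
      g : ℕ → ℤ
      g i = f i ℤ.- f n ℤ.* basis n i

      g≡0 : ∀ i → n ℕ.≤ i → g i ≡ 0ℤ
      g≡0 i n≤i with ℕ.m≤n⇒m<n∨m≡n n≤i
      ... | inj₂ refl
        rewrite monic {n} (λ k → (0ℤ ℤ.+ ℤ.- 1ℤ) ℤ.+ ℤ.- (+ toℕ k ℤ.* α))
        = cancel₁ (f n)
      ... | inj₁ n<i
        rewrite f≡0 i n<i
              | degree≤ {n} (λ k → (0ℤ ℤ.+ ℤ.- 1ℤ) ℤ.+ ℤ.- (+ toℕ k ℤ.* α))
                  (λ _ → 1ℤ) i n<i
        = cancel₀ (f n)

      c  = proj₁ (expand n g g≡0)
      g≡ = proj₂ (expand n g g≡0)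

    expandₚ : ∀ n (p : Poly) → (∀ i → n ℕ.< i → coeff p i ≡ 0ℤ) →
      ∃ λ c → p ≈ expansion α n c
    expandₚ n p deg with expand (suc n) (coeff p) deg
    ... | c , p≡ = c , λ i → trans (p≡ i) (sym (trans
      (coeff-sumₚ (λ k → const (c k) * ⟨ X - const 1ℤ ∣ α ⟩ toℕ k) i)
      (sum-cong-≗ λ k → coeff-const* (c k) (⟨ X - const 1ℤ ∣ α ⟩ toℕ k) i)))
      where
      open CommutativeMonoidSum ℤ.+-0-commutativeMonoid using (sum-cong-≗)

whitneySecondKind-exists : ∀ α → ∃ (IsWhitneySecondKind α)
whitneySecondKind-exists α = (proj₁ ∘ e) , (proj₂ ∘ e)
  where
  e : ∀ n → ∃ λ c → X ^ n ≈ expansion α n c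
  e n = expandₚ α n (X ^ n) λ i n<i →
    trans (cong (λ p → coeff p i) (power n)) (degree≤ {n} (λ _ → 0ℤ) (λ _ → 1ℤ) i n<i)
    where
    power : ∀ n → X ^ n ≡ productₚ {n} (λ _ → linear 0ℤ 1ℤ)
    power zero    = refl
    power (suc n) = cong (X *_) (power n)

whitneyLah-exists : ∀ α → ∃ (IsWhitneyLah α)
whitneyLah-exists α = (proj₁ ∘ e) , (proj₂ ∘ e)
  where
  e : ∀ n → ∃ λ c → ⟨ - X - const 1ℤ ∣ α ⟩ n ≈ expansion α n c
  e n = expandₚ α n (⟨ - X - const 1ℤ ∣ α ⟩ n) (degree≤ {n}
    (λ k → (0ℤ ℤ.+ ℤ.- 1ℤ) ℤ.+ ℤ.- (+ toℕ k ℤ.* α)) (λ _ → ℤ.- 1ℤ))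

{-# OPTIONS --safe #-}

-- Substituting −x for x in the definition of the Whitney numbers and
-- expanding (−x − 1 | α)ⱼ by the Whitney–Lah numbers gives two expansions
-- of xⁿ in the basis (x − 1 | α)ₖ:
--   ∑ₖ W(n,k) (x − 1 | α)ₖ = (−1)ⁿ ∑ⱼ W(n,j) ∑ₖ L(j,k) (x − 1 | α)ₖ.
-- Newton interpolation at the nodes x − 1 = 0, α, 2α, … shows that the
-- coefficients agree, hence so do their sums.
module Submission where

import Defs as Poly
open import Defs using (Triangle; IsWhitneySecondKind; IsWhitneyLah; dowling; sum⁺-syntax)
open import Algebra.Definitions.RawSemiring using (product)
open import Algebra.Properties.Semiring.Sum
  using (sum-cong-≗; *-distribˡ-sum)
open import Data.Fin.Base as Fin using (Fin; toℕ)
open import Data.Fin.Properties using (toℕ≤pred[n])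
open import Data.Integer.Base
  using (ℤ; 0ℤ; 1ℤ; -1ℤ; +_; _+_; _-_; -_; _*_; _^_; _<_; >-nonZero; +-*-rawSemiring)
open import Data.Integer.Properties
open import Data.Integer.Tactic.RingSolver using (solve-∀)
open import Data.List.Base using (List; []; _∷_; map; tabulate)
open import Data.Nat.Base using (ℕ; zero; suc; _∸_)
import Data.Nat.Properties as ℕ
open import Data.Sum.Base using (inj₁; inj₂)
open import Data.Vec.Functional using (Vector)
open import Function.Base using (_∘_)
open import Function.Definitions using (Injective)
open import Relation.Binary.PropositionalEquality
  using (_≡_; refl; sym; trans; cong; cong₂; module ≡-Reasoning)
open import Relation.Nullary.Negation using (contradiction)

open Poly using (sum; _≈_; X; const; ⟨_∣_⟩_; expansion; sumₚ; productₚ)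

-- Nested evaluation of coefficient lists.

∏ : ∀ {n} → Vector ℤ n → ℤ
∏ = product +-*-rawSemiring

-- horner u [c₀, c₁, …] = c₀ + u₀ (c₁ + u₁ (c₂ + ⋯)).  A constant u = x
-- evaluates a polynomial at x, u = 1 sums the coefficients, and
-- u k = y − a k evaluates a Newton form with nodes a at y.
horner : (ℕ → ℤ) → List ℤ → ℤ
horner u []      = 0ℤ
horner u (c ∷ p) = c + u 0 * horner (u ∘ suc) p

horner-+ : ∀ u p q → horner u (p Poly.+ q) ≡ horner u p + horner u q
horner-+ u []      q       = sym (+-identityˡ _)
horner-+ u (a ∷ p) []      = sym (+-identityʳ _)
horner-+ u (a ∷ p) (b ∷ q) =
  trans (cong (λ z → a + b + u 0 * z) (horner-+ (u ∘ suc) p q))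
        (rearrange a b (u 0) _ _)
  where
  rearrange : ∀ a b v s t → a + b + v * (s + t) ≡ a + v * s + (b + v * t)
  rearrange = solve-∀

horner-scale : ∀ u a p → horner u (map (a *_) p) ≡ a * horner u p
horner-scale u a []      = sym (*-zeroʳ a)
horner-scale u a (c ∷ p) =
  trans (cong (λ z → a * c + u 0 * z) (horner-scale (u ∘ suc) a p))
        (rearrange a c (u 0) _)
  where
  rearrange : ∀ a c v s → a * c + v * (a * s) ≡ a * (c + v * s)
  rearrange = solve-∀

horner-neg : ∀ u p → horner u (Poly.- p) ≡ - horner u p
horner-neg u []      = refl
horner-neg u (c ∷ p) =
  trans (cong (λ z → - c + u 0 * z) (horner-neg (u ∘ suc) p))
        (rearrange c (u 0) _)
  where
  rearrange : ∀ c v s → - c + v * (- s) ≡ - (c + v * s)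
  rearrange = solve-∀

horner-sumₚ : ∀ u {n} (v : Vector Poly.Poly n) →
  horner u (sumₚ v) ≡ sum (horner u ∘ v)
horner-sumₚ u {zero}  v = refl
horner-sumₚ u {suc n} v =
  trans (horner-+ u (v Fin.zero) _)
        (cong (λ z → horner u (v Fin.zero) + z) (horner-sumₚ u (v ∘ Fin.suc)))

horner-cong : ∀ u p q → p ≈ q → horner u p ≡ horner u q
horner-cong u []      []      p≈q = refl
-- Lists related by `≈` may differ in length by trailing zeros; the recursion against `[]` shows
-- that the surplus entries contribute 0.
horner-cong u []      (b ∷ q) p≈q =
  trans (sym (trans (+-identityˡ _) (*-zeroʳ (u 0))))
        (cong₂ (λ c s → c + u 0 * s) (p≈q 0) (horner-cong (u ∘ suc) [] q (p≈q ∘ suc)))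
horner-cong u (a ∷ p) []      p≈q =
  trans (cong₂ (λ c s → c + u 0 * s) (p≈q 0) (horner-cong (u ∘ suc) p [] (p≈q ∘ suc)))
        (trans (+-identityˡ _) (*-zeroʳ (u 0)))
horner-cong u (a ∷ p) (b ∷ q) p≈q =
  cong₂ (λ c s → c + u 0 * s) (p≈q 0) (horner-cong (u ∘ suc) p q (p≈q ∘ suc))

-- All terms but the first share the factor `u 0`; pulling it out leaves the same sum for the
-- shifted sequence `u ∘ suc`. This links the nested form to explicit Newton sums.
horner-tabulate : ∀ u {n} (c : Vector ℤ n) →
  horner u (tabulate c) ≡ sum (λ k → c k * ∏ {toℕ k} (u ∘ toℕ))
horner-tabulate u {zero}  c = refl
horner-tabulate u {suc n} c =
  cong₂ _+_ (sym (*-identityʳ (c Fin.zero))) (begin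
    u 0 * horner (u ∘ suc) (tabulate (c ∘ Fin.suc))
      ≡⟨ cong (u 0 *_) (horner-tabulate (u ∘ suc) (c ∘ Fin.suc)) ⟩
    u 0 * sum (λ k → c (Fin.suc k) * ∏ {toℕ k} (u ∘ suc ∘ toℕ))
      ≡⟨ *-distribˡ-sum +-*-semiring (u 0)
           (λ k → c (Fin.suc k) * ∏ {toℕ k} (u ∘ suc ∘ toℕ)) ⟩
    sum (λ k → u 0 * (c (Fin.suc k) * ∏ {toℕ k} (u ∘ suc ∘ toℕ)))
      ≡⟨ sum-cong-≗ +-*-semiring (λ k → swap (u 0) (c (Fin.suc k)) (∏ {toℕ k} (u ∘ suc ∘ toℕ))) ⟩
    sum (λ k → c (Fin.suc k) * ∏ {toℕ (Fin.suc k)} (u ∘ toℕ)) ∎)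
  where
  open ≡-Reasoning

  swap : ∀ x y z → x * (y * z) ≡ y * (x * z)
  swap = solve-∀

horner-1 : ∀ {n} (c : Vector ℤ n) → horner (λ _ → 1ℤ) (tabulate c) ≡ sum c
horner-1 {zero}  c = refl
horner-1 {suc n} c =
  cong (λ z → c Fin.zero + z) (trans (*-identityˡ _) (horner-1 (c ∘ Fin.suc)))

-- Uniqueness of Newton coefficients.

-- At the node `a 0` only the leading entry `c` survives, so `c` is 0. At every later node the value
-- is then a nonzero difference of nodes times the value of the tail, so the tail vanishes at the
-- remaining nodes. The list may still consist of zeros, so the conclusion is stated through
-- `horner` for arbitrary `u` instead of as `p ≡ []`.
newton-zero : (a : ℕ → ℤ) → Injective _≡_ _≡_ a → ∀ p →
  (∀ i → horner (λ k → a i - a k) p ≡ 0ℤ) → ∀ u → horner u p ≡ 0ℤ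
newton-zero a inj []      _    u = refl
newton-zero a inj (c ∷ p) zero-at u = begin
  c + u 0 * horner (u ∘ suc) p
    ≡⟨ cong₂ (λ z s → z + u 0 * s) c≡0 (newton-zero (a ∘ suc) (ℕ.suc-injective ∘ inj) p tail (u ∘ suc)) ⟩
  0ℤ + u 0 * 0ℤ
    ≡⟨ trans (+-identityˡ _) (*-zeroʳ (u 0)) ⟩
  0ℤ ∎
  where
  open ≡-Reasoning

  collapse : ∀ c y s → c ≡ c + (y - y) * s
  collapse = solve-∀

  c≡0 : c ≡ 0ℤ
  c≡0 = trans (collapse c (a 0) _) (zero-at 0)

  tail : ∀ i → horner (λ k → a (suc i) - a (suc k)) p ≡ 0ℤ
  tail i with i*j≡0⇒i≡0∨j≡0 (a (suc i) - a 0)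
                (trans (sym (+-identityˡ _))
                       (trans (cong (λ z → z + _) (sym c≡0)) (zero-at (suc i))))
  -- A vanishing difference would identify the nodes of index `suc i` and 0.
  ... | inj₁ d≡0 = contradiction (inj (i-j≡0⇒i≡j _ _ d≡0)) λ ()
  ... | inj₂ s≡0 = s≡0

-- By linearity this is `newton-zero` for the difference. The free `u` allows passing from values at
-- the nodes straight to sums of coefficients.
newton-unique : (a : ℕ → ℤ) → Injective _≡_ _≡_ a → ∀ p q →
  (∀ i → horner (λ k → a i - a k) p ≡ horner (λ k → a i - a k) q) →
  ∀ u → horner u p ≡ horner u q
newton-unique a inj p q agree u =
  i-j≡0⇒i≡j _ _
    (trans (sym (horner-- u)) (newton-zero a inj (p Poly.- q) difference u))
  where
  horner-- : ∀ u → horner u (p Poly.- q) ≡ horner u p - horner u q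
  horner-- u = trans (horner-+ u p (Poly.- q)) (cong (λ z → horner u p + z) (horner-neg u q))

  difference : ∀ i → horner (λ k → a i - a k) (p Poly.- q) ≡ 0ℤ
  difference i = trans (horner-- _) (i≡j⇒i-j≡0 (agree i))

-- Evaluation of integer polynomials and of their factorial expansions.

eval : ℤ → Poly.Poly → ℤ
eval x = horner (λ _ → x)

eval-* : ∀ x p q → eval x (p Poly.* q) ≡ eval x p * eval x q
eval-* x []      q = refl
eval-* x (a ∷ p) q = begin
  eval x (map (a *_) q Poly.+ (0ℤ ∷ p Poly.* q))
    ≡⟨ horner-+ _ (map (a *_) q) _ ⟩
  eval x (map (a *_) q) + (0ℤ + x * eval x (p Poly.* q))
    ≡⟨ cong₂ (λ s t → s + (0ℤ + x * t)) (horner-scale _ a q) (eval-* x p q) ⟩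
  a * eval x q + (0ℤ + x * (eval x p * eval x q))
    ≡⟨ rearrange a x (eval x p) (eval x q) ⟩
  (a + x * eval x p) * eval x q ∎
  where
  open ≡-Reasoning

  rearrange : ∀ a x s t → a * t + (0ℤ + x * (s * t)) ≡ (a + x * s) * t
  rearrange = solve-∀

eval-const : ∀ x a → eval x (const a) ≡ a
eval-const x a = trans (cong (λ z → a + z) (*-zeroʳ x)) (+-identityʳ a)

eval-X^ : ∀ x n → eval x (X Poly.^ n) ≡ x ^ n
eval-X^ x zero    = eval-const x 1ℤ
eval-X^ x (suc n) =
  trans (eval-* x X (X Poly.^ n)) (cong₂ _*_ (eval-X x) (eval-X^ x n))
  where
  eval-X : ∀ x → 0ℤ + x * (1ℤ + x * 0ℤ) ≡ x
  eval-X = solve-∀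

-- Integer counterpart of `⟨_∣_⟩_`, shaped to coincide by computation with the products in
-- `horner-tabulate` for `u k = y - + k * α`.
falling : ℤ → ℤ → ℕ → ℤ
falling α y k = ∏ {k} λ i → y - + toℕ i * α

eval-productₚ : ∀ x {n} (v : Vector Poly.Poly n) (w : Vector ℤ n) →
  (∀ i → eval x (v i) ≡ w i) → eval x (productₚ v) ≡ ∏ w
eval-productₚ x {zero}  v w v≡w = eval-const x 1ℤ
eval-productₚ x {suc n} v w v≡w =
  trans (eval-* x (v Fin.zero) _)
        (cong₂ _*_ (v≡w Fin.zero)
                   (eval-productₚ x (v ∘ Fin.suc) (w ∘ Fin.suc) (v≡w ∘ Fin.suc)))

eval-falling : ∀ x α p k → eval x (⟨ p ∣ α ⟩ k) ≡ falling α (eval x p) k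
eval-falling x α p k = eval-productₚ x {k} _ _ λ i →
  trans (horner-+ _ p _) (cong (λ z → eval x p + z) (eval-const x (- (+ toℕ i * α))))

eval-expansion : ∀ x α n c →
  eval x (expansion α n c) ≡
  ∑[ k ≤ n ] (c k * falling α (eval x (X Poly.- const 1ℤ)) (toℕ k))
eval-expansion x α n c =
  trans (horner-sumₚ _ λ k → const (c k) Poly.* ⟨ X Poly.- const 1ℤ ∣ α ⟩ toℕ k)
        (sum-cong-≗ +-*-semiring λ k →
          trans (eval-* x (const (c k)) (⟨ X Poly.- const 1ℤ ∣ α ⟩ toℕ k))
                (cong₂ _*_ (eval-const x (c k)) (eval-falling x α (X Poly.- const 1ℤ) (toℕ k))))

eval-X-1 : ∀ y → eval (1ℤ + y) (X Poly.- const 1ℤ) ≡ y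
eval-X-1 = identity
  where
  identity : ∀ y → (0ℤ + - 1ℤ) + (1ℤ + y) * (1ℤ + (1ℤ + y) * 0ℤ) ≡ y
  identity = solve-∀

eval--X-1 : ∀ x → eval (- x) (X Poly.- const 1ℤ) ≡ eval x (Poly.- X Poly.- const 1ℤ)
eval--X-1 = identity
  where
  identity : ∀ x → (0ℤ + - 1ℤ) + (- x) * (1ℤ + (- x) * 0ℤ) ≡
                   (- 0ℤ + - 1ℤ) + x * (- 1ℤ + x * 0ℤ)
  identity = solve-∀

-- The basis is built on `X - 1`, so the shift to `1 + y` turns the expansion into a Newton form at
-- `y` with nodes 0, α, 2α, ....
eval-newton : ∀ α n c y →
  eval (1ℤ + y) (expansion α n c) ≡ horner (λ k → y - + k * α) (tabulate c)
eval-newton α n c y = begin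
  eval (1ℤ + y) (expansion α n c)
    ≡⟨ eval-expansion (1ℤ + y) α n c ⟩
  (∑[ k ≤ n ] (c k * falling α (eval (1ℤ + y) (X Poly.- const 1ℤ)) (toℕ k)))
    ≡⟨ cong (λ z → ∑[ k ≤ n ] (c k * falling α z (toℕ k))) (eval-X-1 y) ⟩
  (∑[ k ≤ n ] (c k * falling α y (toℕ k)))
    ≡⟨ horner-tabulate (λ k → y - + k * α) c ⟨
  horner (λ k → y - + k * α) (tabulate c) ∎
  where open ≡-Reasoning

-- Comparison of the two expansions of a power.

^-neg : ∀ x n → x ^ n ≡ -1ℤ ^ n * (- x) ^ n
^-neg x zero    = refl
^-neg x (suc n) =
  trans (cong (x *_) (^-neg x n)) (rearrange x (-1ℤ ^ n) ((- x) ^ n))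
  where
  rearrange : ∀ x s t → x * (s * t) ≡ (- 1ℤ * s) * (- x * t)
  rearrange = solve-∀

-- The lists hold Newton coefficients here; polynomial addition is reused because it pads lists of
-- different lengths with zeros.
combination : ∀ {n} → Vector ℤ n → Vector (List ℤ) n → List ℤ
combination b q = sumₚ λ j → map (b j *_) (q j)

horner-combination : ∀ u {n} (b : Vector ℤ n) q →
  horner u (combination b q) ≡ sum (λ j → b j * horner u (q j))
horner-combination u b q =
  trans (horner-sumₚ u λ j → map (b j *_) (q j))
        (sum-cong-≗ +-*-semiring λ j → horner-scale u (b j) (q j))

multiples-injective : ∀ {α} → 0ℤ < α → Injective _≡_ _≡_ (λ i → + i * α)
multiples-injective {α} 0<α {i} {j} eq =
  +-injective (*-cancelʳ-≡ (+ i) (+ j) α {{>-nonZero 0<α}} eq)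

module _ (W L : Triangle) (n : ℕ) where

  -- Newton coefficients of (-1)ⁿ ∑ⱼ W(n,j) (-x - 1 | α)ⱼ in the variable x - 1.
  lahCombination : List ℤ
  lahCombination =
    combination (λ j → -1ℤ ^ n * W n j) (λ j → tabulate (L (toℕ j)))

  newton-agree : ∀ α → IsWhitneySecondKind α W → IsWhitneyLah α L → ∀ y →
    horner (λ k → y - + k * α) (tabulate (W n)) ≡
    horner (λ k → y - + k * α) lahCombination
  newton-agree α isW isL y = begin
    horner u (tabulate (W n))
      ≡⟨ eval-newton α n (W n) y ⟨
    eval x (expansion α n (W n))
      ≡⟨ horner-cong (λ _ → x) (X Poly.^ n) (expansion α n (W n)) (isW n) ⟨
    eval x (X Poly.^ n)
      ≡⟨ eval-X^ x n ⟩
    x ^ n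
      ≡⟨ ^-neg x n ⟩
    -1ℤ ^ n * (- x) ^ n
      ≡⟨ cong (-1ℤ ^ n *_) (eval-X^ (- x) n) ⟨
    -1ℤ ^ n * eval (- x) (X Poly.^ n)
      -- The Whitney identity is used a second time, now at `- x`.
      ≡⟨ cong (-1ℤ ^ n *_) (horner-cong (λ _ → - x) (X Poly.^ n) (expansion α n (W n)) (isW n)) ⟩
    -1ℤ ^ n * eval (- x) (expansion α n (W n))
      ≡⟨ cong (-1ℤ ^ n *_) (eval-expansion (- x) α n (W n)) ⟩
    -1ℤ ^ n * (∑[ j ≤ n ] (W n j * falling α (eval (- x) (X Poly.- const 1ℤ)) (toℕ j)))
      ≡⟨ *-distribˡ-sum +-*-semiring (-1ℤ ^ n)
           (λ j → W n j * falling α (eval (- x) (X Poly.- const 1ℤ)) (toℕ j)) ⟩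
    (∑[ j ≤ n ] (-1ℤ ^ n * (W n j * falling α (eval (- x) (X Poly.- const 1ℤ)) (toℕ j))))
      ≡⟨ sum-cong-≗ +-*-semiring (λ j →
           trans (sym (*-assoc (-1ℤ ^ n) (W n j) _))
                 (cong (-1ℤ ^ n * W n j *_) (falling-lah (toℕ j)))) ⟩
    (∑[ j ≤ n ] (-1ℤ ^ n * W n j * horner u (tabulate (L (toℕ j)))))
      ≡⟨ horner-combination u (λ j → -1ℤ ^ n * W n j) (λ j → tabulate (L (toℕ j))) ⟨
    horner u lahCombination ∎
    where
    open ≡-Reasoning

    x : ℤ
    x = 1ℤ + y

    u : ℕ → ℤ
    u k = y - + k * α

    -- Evaluating `X - 1` at `- x` agrees with evaluating `- X - 1` at `x`, so the Whitney-Lah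
    -- identity applies at the original point.
    falling-lah : ∀ j →
      falling α (eval (- x) (X Poly.- const 1ℤ)) j ≡ horner u (tabulate (L j))
    falling-lah j = begin
      falling α (eval (- x) (X Poly.- const 1ℤ)) j
        ≡⟨ cong (λ z → falling α z j) (eval--X-1 x) ⟩
      falling α (eval x (Poly.- X Poly.- const 1ℤ)) j
        ≡⟨ eval-falling x α (Poly.- X Poly.- const 1ℤ) j ⟨
      eval x (⟨ Poly.- X Poly.- const 1ℤ ∣ α ⟩ j)
        ≡⟨ horner-cong (λ _ → x) (⟨ Poly.- X Poly.- const 1ℤ ∣ α ⟩ j) (expansion α j (L j)) (isL j) ⟩
      eval x (expansion α j (L j))
        ≡⟨ eval-newton α j (L j) y ⟩
      horner u (tabulate (L j)) ∎

  regroup : ∀ (j : Fin (suc n)) →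
    -1ℤ ^ n * W n j * horner (λ _ → 1ℤ) (tabulate (L (toℕ j))) ≡
    -1ℤ ^ (n ∸ toℕ j) * (∑[ k ≤ toℕ j ] (-1ℤ ^ toℕ j * L (toℕ j) k)) * W n j
  regroup j = begin
    -1ℤ ^ n * W n j * horner (λ _ → 1ℤ) (tabulate (L (toℕ j)))
      ≡⟨ cong₂ (λ s t → s * W n j * t) sign (horner-1 (L (toℕ j))) ⟩
    -1ℤ ^ (n ∸ toℕ j) * -1ℤ ^ toℕ j * W n j * sum (L (toℕ j))
      ≡⟨ rearrange (-1ℤ ^ (n ∸ toℕ j)) (-1ℤ ^ toℕ j) (W n j) (sum (L (toℕ j))) ⟩
    -1ℤ ^ (n ∸ toℕ j) * (-1ℤ ^ toℕ j * sum (L (toℕ j))) * W n j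
      ≡⟨ cong (λ s → -1ℤ ^ (n ∸ toℕ j) * s * W n j)
              (*-distribˡ-sum +-*-semiring (-1ℤ ^ toℕ j) (L (toℕ j))) ⟩
    -1ℤ ^ (n ∸ toℕ j) * (∑[ k ≤ toℕ j ] (-1ℤ ^ toℕ j * L (toℕ j) k)) * W n j ∎
    where
    open ≡-Reasoning

    sign : -1ℤ ^ n ≡ -1ℤ ^ (n ∸ toℕ j) * -1ℤ ^ toℕ j
    -- Truncated subtraction is exact here because `toℕ j` is at most `n`.
    sign = trans (cong (-1ℤ ^_) (sym (ℕ.m∸n+n≡m (toℕ≤pred[n] j))))
                 (^-distribˡ-+-* -1ℤ (n ∸ toℕ j) (toℕ j))

    rearrange : ∀ s t w l → s * t * w * l ≡ s * (t * l) * w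
    rearrange = solve-∀

theorem3p2 : (α : ℤ) → 0ℤ < α → (W L : Triangle) →
    IsWhitneySecondKind α W → IsWhitneyLah α L → (n : ℕ) →
    dowling W n ≡ ∑[ j ≤ n ] (-1ℤ ^ (n ∸ toℕ j) * (∑[ k ≤ toℕ j ] (-1ℤ ^ toℕ j * L (toℕ j) k)) * W n j)
theorem3p2 α 0<α W L isW isL n = begin
  sum (W n)
    ≡⟨ horner-1 (W n) ⟨
  horner (λ _ → 1ℤ) (tabulate (W n))
    -- Positivity of `α` makes the nodes distinct; the constant sequence 1 in place of `u` extracts
    -- the sums of the coefficients.
    ≡⟨ newton-unique (λ i → + i * α) (multiples-injective 0<α) (tabulate (W n)) (lahCombination W L n)
         (λ i → newton-agree W L n α isW isL (+ i * α)) (λ _ → 1ℤ) ⟩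
  horner (λ _ → 1ℤ) (lahCombination W L n)
    ≡⟨ horner-combination (λ _ → 1ℤ) (λ j → -1ℤ ^ n * W n j) (λ j → tabulate (L (toℕ j))) ⟩
  (∑[ j ≤ n ] (-1ℤ ^ n * W n j * horner (λ _ → 1ℤ) (tabulate (L (toℕ j)))))
    ≡⟨ sum-cong-≗ +-*-semiring (regroup W L n) ⟩
  (∑[ j ≤ n ] (-1ℤ ^ (n ∸ toℕ j) * (∑[ k ≤ toℕ j ] (-1ℤ ^ toℕ j * L (toℕ j) k)) * W n j)) ∎
  where
  open ≡-Reasoning
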